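{- Let $\pi=(\pi_1,\ldots,\pi_n)$ be an autotopy of $C\in\mathcal{P}^n(v,k,\lambda)$. Then every component $\pi_x$, $x\in\{1,\ldots,n\}$, has the same number of fixed points.
   Context: An incidence matrix of a symmetric $(v,k,\lambda)$ design is a $v\times v$ matrix $A$ with $\{0,1\}$-entries satisfying $AA^t=(k-\lambda)I+\lambda J$, where $I$ is the identity matrix and $J$ the all-ones matrix; parameters are assumed nondegenerate, $0\le\lambda<k$. For $n\ge 2$, $\mathcal{P}^n(v,k,\lambda)$ is the set of all functions $C:\{1,\ldots,v\}^n\to\{0,1\}$ such that for all $1\le x<y\le n$ the $2$-projection $\Pi_{xy}(C)$ is an incidence matrix of a symmetric $(v,k,\lambda)$ design; here $\Pi_{xy}(C)$ is the $v\times v$ matrix whose $(i_x,i_y)$-entry is the sum (in characteristic $0$) of $C(i_1,\ldots,i_n)$ over all $n$-tuples in $\{1,\ldots,v\}^n$ with the given coordinates $i_x,i_y$. An autotopy of $C$ is an $n$-tuple $(\pi_1,\ldots,\pi_n)\in (S_v)^n$ such that $C(i_1,\ldots,i_n)=C(\pi_1^{ -1}(i_1),\ldots,\pi_n^{ -1}(i_n))$ for all $i_1,\ldots,i_n\in\{1,\ldots,v\}$. -}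

module Defs where

open import Algebra.Properties.Semiring.Sum using (sum-syntax)
open import Data.Bool.Base using (if_then_else_)
open import Data.Fin.Base as Fin using (Fin; toℕ)
open import Data.Fin.Permutation using (Permutation′; _⟨$⟩ʳ_; _⟨$⟩ˡ_)
open import Data.Fin.Properties using (_≟_)
open import Data.List.Base as List using (List)
open import Data.Nat.Base using (ℕ; zero; suc; _+_; _*_; _∸_)
open import Data.Nat.ListAction using (sum)
open import Data.Nat.Properties using (+-*-semiring)
open import Data.Sum.Base using (_⊎_)
open import Data.Vec.Base as Vec using (Vec; []; _∷_; lookup)
open import Relation.Binary.PropositionalEquality using (_≡_)
open import Relation.Nullary.Decidable using (does; _×-dec_)

Matrix : ℕ → Set
Matrix v = Fin v → Fin v → ℕ

𝟙 : ∀ {v} → Matrix v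
𝟙 i j = if does (i ≟ j) then 1 else 0

𝕁 : ∀ {v} → Matrix v
𝕁 _ _ = 1

infix 8 _ᵗ
infixl 7 _⊗_ _·_
infixl 6 _⊕_

_ᵗ : ∀ {v} → Matrix v → Matrix v
(A ᵗ) i j = A j i

_⊗_ : ∀ {v} → Matrix v → Matrix v → Matrix v
_⊗_ {v} A B i j = sum-syntax +-*-semiring v (λ l → A i l * B l j)

_⊕_ : ∀ {v} → Matrix v → Matrix v → Matrix v
(A ⊕ B) i j = A i j + B i j

_·_ : ∀ {v} → ℕ → Matrix v → Matrix v
(c · A) i j = c * A i j

-- The truncated subtraction k ∸ μ is the true difference only for μ ≤ k.
-- Nondegeneracy, μ < k, is not part of this record and has to be assumed
-- separately.
record IsIncidenceMatrix (v k μ : ℕ) (A : Matrix v) : Set where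
  field
    zero-one : ∀ i j → A i j ≡ 0 ⊎ A i j ≡ 1
    gram     : ∀ i j → (A ⊗ A ᵗ) i j ≡ ((k ∸ μ) · 𝟙 ⊕ μ · 𝕁) i j

Tuple : ℕ → ℕ → Set
Tuple n v = Vec (Fin v) n

-- Lists every tuple exactly once.
allTuples : ∀ n v → List (Tuple n v)
allTuples zero    v = List.[ [] ]
allTuples (suc n) v = List.cartesianProductWith _∷_ (List.allFin v) (allTuples n v)

ZeroOneArray : ℕ → ℕ → Set
ZeroOneArray n v = Tuple n v → Fin 2

Π : ∀ {n v} → Fin n → Fin n → ZeroOneArray n v → Matrix v
Π {n} {v} x y C i j =
  sum (List.map (λ t → toℕ (C t))
    (List.filter (λ t → (lookup t x ≟ i) ×-dec (lookup t y ≟ j))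
      (allTuples n v)))

𝒫 : (n v k μ : ℕ) → ZeroOneArray n v → Set
𝒫 n v k μ C = ∀ (x y : Fin n) → x Fin.< y → IsIncidenceMatrix v k μ (Π x y C)

-- _⟨$⟩ˡ_ applies the inverse permutation.
IsAutotopy : ∀ {n v} → Vec (Permutation′ v) n → ZeroOneArray n v → Set
IsAutotopy {n} {v} π C =
  ∀ (t : Tuple n v) → C t ≡ C (Vec.zipWith _⟨$⟩ˡ_ π t)

#fixedPoints : ∀ {v} → Permutation′ v → ℕ
#fixedPoints {v} σ = Vec.count (λ i → (σ ⟨$⟩ʳ i) ≟ i) (Vec.allFin v)

{-# OPTIONS --safe #-}

-- Write A for a projection Π x y C, p and q for the components of the
-- autotopy at x and y, d = k − μ and e = d + vμ.  The Gram condition says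
-- A Aᵗ = d I + μ J, so X = e Aᵗ − μ Aᵗ J satisfies A X = D I with D = e d > 0,
-- and X A is symmetric.  The squared entries of X A − D I add up to
-- tr ((X A)²) − 2 D tr (X A) + D² v = 0, hence also X A = D I.
-- Since A is invariant under (p , q),
-- D · fix q = Σⱼ (X A) (j , q j) = Σₗ (A X) (p⁻¹ l , l) = D · fix p.
module Submission where

open import Defs
import Algebra.Properties.Semiring.Sum as Sum
open import Data.Bool.Base using (true; false; if_then_else_)
open import Data.Fin.Base as Fin using (Fin; zero; suc; toℕ)
open import Data.Fin.Permutation
  using (Permutation′; _⟨$⟩ʳ_; _⟨$⟩ˡ_; flip; inverseˡ; inverseʳ)
open import Data.Fin.Properties using (_≟_; <-cmp)
open import Data.Integer.Base as ℤ using (ℤ; +_; 0ℤ; 1ℤ; +≤+; +[1+_]; -[1+_])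
import Data.Integer.Properties as ℤ
open import Data.Integer.Tactic.RingSolver using (solve-∀)
open import Data.List.Base as List using (List)
open import Data.List.Properties using (map-++; map-∘; map-cong)
open import Data.Nat.Base using (ℕ; zero; suc; _+_; _*_; _∸_; _≤_; _<_; z≤n; >-nonZero)
open import Data.Nat.ListAction using (sum)
open import Data.Nat.ListAction.Properties using (sum-++)
open import Data.Nat.Properties using (+-*-semiring; *-identityʳ; m<n⇒0<n∸m; m≤m+n; ≤-trans)
open import Data.Product.Function.NonDependent.Propositional using (_×-⇔_)
open import Data.Sum.Base using (reduce)
open import Data.Vec.Base as Vec using (Vec; []; _∷_; lookup)
open import Data.Vec.Properties using (lookup-zipWith)
open import Function.Base using (_∘_)
open import Function.Bundles using (_⇔_; mk⇔)
open import Level using (Level)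
open import Relation.Binary.Definitions using (tri<; tri≈; tri>)
open import Relation.Binary.PropositionalEquality
  using (_≡_; refl; sym; trans; cong; cong₂; subst; module ≡-Reasoning)
open import Relation.Nullary.Decidable using (does; does-⇔; _×-dec_)
open import Relation.Unary using (Pred; Decidable)

module ℕ∑ = Sum +-*-semiring
open Sum ℤ.+-*-semiring
  using (sum-syntax; sum-cong-≗; ∑-distrib-+; ∑-comm; ∑-permute;
         *-distribˡ-sum; *-distribʳ-sum)
open ≡-Reasoning

private
  variable
    a p : Level
    A : Set a
    n v : ℕ

-- Finite sums of integers.

pos-∑ : (f : Fin n → ℕ) →
        + (ℕ∑.sum-syntax n f) ≡ ∑[ i < n ] (+ f i)
pos-∑ {zero}  f = refl
pos-∑ {suc n} f = cong (ℤ._+_ (+ f zero)) (pos-∑ (f ∘ suc))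

∑-const : ∀ n (c : ℤ) → ∑[ _ < n ] c ≡ + n ℤ.* c
∑-const zero    c = sym (ℤ.*-zeroˡ c)
∑-const (suc n) c = trans (cong (ℤ._+_ c) (∑-const n c)) (sym (ℤ.suc-* (+ n) c))

∑-linear : ∀ (f g h : Fin v → ℤ) a b →
  ∑[ j < v ] (f j ℤ.* (a ℤ.* g j ℤ.- b ℤ.* h j)) ≡
  a ℤ.* ∑[ j < v ] (f j ℤ.* g j) ℤ.- b ℤ.* ∑[ j < v ] (f j ℤ.* h j)
∑-linear {v} f g h a b = begin
  ∑[ j < v ] (f j ℤ.* (a ℤ.* g j ℤ.- b ℤ.* h j))
    ≡⟨ sum-cong-≗ (λ j → expand (f j) (g j) (h j) a b) ⟩
  ∑[ j < v ] (a ℤ.* (f j ℤ.* g j) ℤ.+ ℤ.- b ℤ.* (f j ℤ.* h j))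
    ≡⟨ ∑-distrib-+ (λ j → a ℤ.* (f j ℤ.* g j)) (λ j → ℤ.- b ℤ.* (f j ℤ.* h j)) ⟩
  ∑[ j < v ] (a ℤ.* (f j ℤ.* g j)) ℤ.+ ∑[ j < v ] (ℤ.- b ℤ.* (f j ℤ.* h j))
    ≡⟨ cong₂ ℤ._+_ (*-distribˡ-sum a (λ j → f j ℤ.* g j))
                   (*-distribˡ-sum (ℤ.- b) (λ j → f j ℤ.* h j)) ⟨
  a ℤ.* ∑[ j < v ] (f j ℤ.* g j) ℤ.+ ℤ.- b ℤ.* ∑[ j < v ] (f j ℤ.* h j)
    ≡⟨ cong (ℤ._+_ (a ℤ.* ∑[ j < v ] (f j ℤ.* g j)))
            (ℤ.neg-distribˡ-* b (∑[ j < v ] (f j ℤ.* h j))) ⟨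
  a ℤ.* ∑[ j < v ] (f j ℤ.* g j) ℤ.- b ℤ.* ∑[ j < v ] (f j ℤ.* h j) ∎
  where
  expand : ∀ f g h a b → f ℤ.* (a ℤ.* g ℤ.- b ℤ.* h)
         ≡ a ℤ.* (f ℤ.* g) ℤ.+ ℤ.- b ℤ.* (f ℤ.* h)
  expand = solve-∀

∑-nonneg : (f : Fin n → ℤ) → (∀ i → 0ℤ ℤ.≤ f i) → 0ℤ ℤ.≤ ∑[ i < n ] f i
∑-nonneg {zero}  f f≥0 = ℤ.≤-refl
∑-nonneg {suc n} f f≥0 = ℤ.+-mono-≤ (f≥0 zero) (∑-nonneg (f ∘ suc) (f≥0 ∘ suc))

nonneg-+≡0ˡ : ∀ {i j} → 0ℤ ℤ.≤ i → 0ℤ ℤ.≤ j → i ℤ.+ j ≡ 0ℤ → i ≡ 0ℤ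
-- A positive first summand would make the sum a successor, which leaves this single case.
nonneg-+≡0ˡ {+ zero} (+≤+ _) (+≤+ _) _ = refl

∑-nonneg-≡0 : (f : Fin n → ℤ) → (∀ i → 0ℤ ℤ.≤ f i) →
              ∑[ i < n ] f i ≡ 0ℤ → ∀ i → f i ≡ 0ℤ
∑-nonneg-≡0 {suc n} f f≥0 ∑≡0 i = go i
  where
  tail≥0 = ∑-nonneg (f ∘ suc) (f≥0 ∘ suc)
  go : ∀ i → f i ≡ 0ℤ
  go zero    = nonneg-+≡0ˡ (f≥0 zero) tail≥0 ∑≡0
  go (suc i) = ∑-nonneg-≡0 (f ∘ suc) (f≥0 ∘ suc)
    (nonneg-+≡0ˡ tail≥0 (f≥0 zero) (trans (ℤ.+-comm _ (f zero)) ∑≡0)) i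

i*i≥0 : ∀ i → 0ℤ ℤ.≤ i ℤ.* i
i*i≥0 (+ zero)  = +≤+ z≤n
i*i≥0 +[1+ n ]  = +≤+ z≤n
i*i≥0 -[1+ n ]  = +≤+ z≤n

-- Integer matrices, the identity matrix and the trace.

Matrixℤ : ℕ → Set
Matrixℤ v = Fin v → Fin v → ℤ

infixl 7 _∙_

_∙_ : Matrixℤ v → Matrixℤ v → Matrixℤ v
_∙_ {v} A B i j = ∑[ l < v ] (A i l ℤ.* B l j)

δ : Matrixℤ v
δ i j = + 𝟙 i j

tr : Matrixℤ v → ℤ
tr {v} A = ∑[ i < v ] A i i

-- `δ` depends only on the truth value of the equation, so even entries of identity matrices of
-- different sizes can be compared.
δ-cong : ∀ {m n} {i j : Fin m} {k l : Fin n} → (i ≡ j ⇔ k ≡ l) → δ i j ≡ δ k l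
δ-cong {i = i} {j} {k} {l} eqv =
  cong (λ b → + (if b then 1 else 0)) (does-⇔ eqv (i ≟ j) (k ≟ l))

δ-refl : (i : Fin v) → δ i i ≡ 1ℤ
-- For a variable `i` the test `i ≟ i` does not compute; `zero ≟ zero` in `Fin 1` does.
δ-refl i = δ-cong {i = i} {i} {zero {0}} {zero} (mk⇔ (λ _ → refl) (λ _ → refl))

δ-sym : (i j : Fin v) → δ i j ≡ δ j i
δ-sym i j = δ-cong {i = i} {j} {j} {i} (mk⇔ sym sym)

∑-δ : (i : Fin v) (f : Fin v → ℤ) → ∑[ j < v ] (δ i j ℤ.* f j) ≡ f i
∑-δ {suc v} zero f = begin
  1ℤ ℤ.* f zero ℤ.+ ∑[ j < v ] (0ℤ ℤ.* f (suc j))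
    ≡⟨ cong₂ ℤ._+_ (ℤ.*-identityˡ (f zero)) (sum-cong-≗ (ℤ.*-zeroˡ ∘ f ∘ suc)) ⟩
  f zero ℤ.+ ∑[ j < v ] 0ℤ   ≡⟨ cong (ℤ._+_ (f zero)) (∑-const v 0ℤ) ⟩
  f zero ℤ.+ + v ℤ.* 0ℤ      ≡⟨ cong (ℤ._+_ (f zero)) (ℤ.*-zeroʳ (+ v)) ⟩
  f zero ℤ.+ 0ℤ              ≡⟨ ℤ.+-identityʳ (f zero) ⟩
  f zero                     ∎
∑-δ {suc v} (suc i) f = begin
  0ℤ ℤ.* f zero ℤ.+ ∑[ j < v ] (δ i j ℤ.* f (suc j))
    ≡⟨ cong₂ ℤ._+_ (ℤ.*-zeroˡ (f zero)) (∑-δ i (f ∘ suc)) ⟩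
  0ℤ ℤ.+ f (suc i)  ≡⟨ ℤ.+-identityˡ (f (suc i)) ⟩
  f (suc i)         ∎

∙-assoc : (A B C : Matrixℤ v) → ∀ i j → (A ∙ B ∙ C) i j ≡ (A ∙ (B ∙ C)) i j
∙-assoc {v} A B C i j = begin
  ∑[ m < v ] (∑[ l < v ] (A i l ℤ.* B l m) ℤ.* C m j)
    ≡⟨ sum-cong-≗ (λ m → *-distribʳ-sum (C m j) (λ l → A i l ℤ.* B l m)) ⟩
  ∑[ m < v ] ∑[ l < v ] (A i l ℤ.* B l m ℤ.* C m j)
    ≡⟨ ∑-comm (λ m l → A i l ℤ.* B l m ℤ.* C m j) ⟩
  ∑[ l < v ] ∑[ m < v ] (A i l ℤ.* B l m ℤ.* C m j)
    ≡⟨ sum-cong-≗ (λ l → sum-cong-≗ (λ m → ℤ.*-assoc (A i l) (B l m) (C m j))) ⟩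
  ∑[ l < v ] ∑[ m < v ] (A i l ℤ.* (B l m ℤ.* C m j))
    ≡⟨ sum-cong-≗ (λ l → *-distribˡ-sum (A i l) (λ m → B l m ℤ.* C m j)) ⟨
  ∑[ l < v ] (A i l ℤ.* ∑[ m < v ] (B l m ℤ.* C m j)) ∎

tr-comm : (A B : Matrixℤ v) → tr (A ∙ B) ≡ tr (B ∙ A)
tr-comm A B = trans (∑-comm (λ i l → A i l ℤ.* B l i))
  (sum-cong-≗ (λ l → sum-cong-≗ (λ i → ℤ.*-comm (A i l) (B l i))))

-- From a right inverse up to a scalar to a left one.

module _ (A X : Matrixℤ v) (D : ℤ)
         (AX≡D : ∀ i j → (A ∙ X) i j ≡ D ℤ.* δ i j) where

  private
    N E : Matrixℤ v
    N = X ∙ A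
    E i j = N i j ℤ.- D ℤ.* δ i j

  -- Regrouping X A X A as X ((A X) A) exposes the inner product A X, which is the scalar `D`.
  XA-idempotent : ∀ i j → (N ∙ N) i j ≡ D ℤ.* N i j
  XA-idempotent i j = begin
    (X ∙ A ∙ N) i j  ≡⟨ ∙-assoc X A N i j ⟩
    (X ∙ (A ∙ N)) i j
      ≡⟨ sum-cong-≗ (λ l → cong (X i l ℤ.*_) (A∙N≡D*A l)) ⟩
    ∑[ l < v ] (X i l ℤ.* (D ℤ.* A l j))
      ≡⟨ sum-cong-≗ (λ l → swap (X i l) D (A l j)) ⟩
    ∑[ l < v ] (D ℤ.* (X i l ℤ.* A l j))
      ≡⟨ *-distribˡ-sum D (λ l → X i l ℤ.* A l j) ⟨
    D ℤ.* N i j ∎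
    where
    swap : ∀ a b c → a ℤ.* (b ℤ.* c) ≡ b ℤ.* (a ℤ.* c)
    swap = solve-∀
    A∙N≡D*A : ∀ l → (A ∙ N) l j ≡ D ℤ.* A l j
    A∙N≡D*A l = begin
      (A ∙ N) l j      ≡⟨ ∙-assoc A X A l j ⟨
      (A ∙ X ∙ A) l j  ≡⟨ sum-cong-≗ (λ m → cong (ℤ._* A m j) (AX≡D l m)) ⟩
      ∑[ m < v ] (D ℤ.* δ l m ℤ.* A m j)
        ≡⟨ sum-cong-≗ (λ m → ℤ.*-assoc D (δ l m) (A m j)) ⟩
      ∑[ m < v ] (D ℤ.* (δ l m ℤ.* A m j))
        ≡⟨ *-distribˡ-sum D (λ m → δ l m ℤ.* A m j) ⟨
      D ℤ.* ∑[ m < v ] (δ l m ℤ.* A m j)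
        ≡⟨ cong (D ℤ.*_) (∑-δ l (λ m → A m j)) ⟩
      D ℤ.* A l j ∎

  -- Cyclicity of the trace. The sum of `D` stays unevaluated because it meets the same expression
  -- in `∑-squares` and cancels there.
  tr-XA : tr N ≡ ∑[ _ < v ] D
  tr-XA = begin
    tr (X ∙ A)  ≡⟨ tr-comm X A ⟩
    tr (A ∙ X)  ≡⟨ sum-cong-≗ (λ i → AX≡D i i) ⟩
    ∑[ i < v ] (D ℤ.* δ i i)
      ≡⟨ sum-cong-≗ {v} (λ i → trans (cong (D ℤ.*_) (δ-refl i)) (ℤ.*-identityʳ D)) ⟩
    ∑[ _ < v ] D ∎

  module _ (XA-sym : ∀ i j → N i j ≡ N j i) where

    -- Symmetry of `N` turns the sum of squares along row `i` into a diagonal entry of `N ∙ N`,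
    -- which `XA-idempotent` evaluates.
    ∑-row-squares : ∀ i → ∑[ j < v ] (E i j ℤ.* E i j) ≡ D ℤ.* (D ℤ.+ ℤ.- N i i)
    ∑-row-squares i = begin
      ∑[ j < v ] (E i j ℤ.* E i j)
        -- All terms beyond the square of `N i j` contain `δ i j`. One such factor is pulled out for
        -- `∑-δ`; the other stays inside `g` and becomes `δ i i` after the sum collapses.
        ≡⟨ sum-cong-≗ (λ j → trans (expand (N i j) D (δ i j))
             (cong (λ x → N i j ℤ.* x ℤ.+ δ i j ℤ.* g j) (XA-sym i j))) ⟩
      ∑[ j < v ] (N i j ℤ.* N j i ℤ.+ δ i j ℤ.* g j)
        ≡⟨ ∑-distrib-+ (λ j → N i j ℤ.* N j i) (λ j → δ i j ℤ.* g j) ⟩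
      (N ∙ N) i i ℤ.+ ∑[ j < v ] (δ i j ℤ.* g j)
        ≡⟨ cong₂ ℤ._+_ (XA-idempotent i i) (∑-δ i g) ⟩
      D ℤ.* N i i ℤ.+ g i
        ≡⟨ cong (λ x → D ℤ.* N i i ℤ.+ D ℤ.* (D ℤ.* x ℤ.- + 2 ℤ.* N i i)) (δ-refl i) ⟩
      D ℤ.* N i i ℤ.+ D ℤ.* (D ℤ.* 1ℤ ℤ.- + 2 ℤ.* N i i)
        ≡⟨ collect D (N i i) ⟩
      D ℤ.* (D ℤ.+ ℤ.- N i i) ∎
      where
      g : Fin v → ℤ
      g j = D ℤ.* (D ℤ.* δ i j ℤ.- + 2 ℤ.* N i j)
      expand : ∀ x d e → (x ℤ.- d ℤ.* e) ℤ.* (x ℤ.- d ℤ.* e)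
             ≡ x ℤ.* x ℤ.+ e ℤ.* (d ℤ.* (d ℤ.* e ℤ.- + 2 ℤ.* x))
      expand = solve-∀
      collect : ∀ d x → d ℤ.* x ℤ.+ d ℤ.* (d ℤ.* 1ℤ ℤ.- + 2 ℤ.* x) ≡ d ℤ.* (d ℤ.+ ℤ.- x)
      collect = solve-∀

    ∑-squares : ∑[ i < v ] ∑[ j < v ] (E i j ℤ.* E i j) ≡ 0ℤ
    ∑-squares = begin
      ∑[ i < v ] ∑[ j < v ] (E i j ℤ.* E i j)
        ≡⟨ sum-cong-≗ ∑-row-squares ⟩
      ∑[ i < v ] (D ℤ.* (D ℤ.+ ℤ.- N i i))
        ≡⟨ *-distribˡ-sum D (λ i → D ℤ.+ ℤ.- N i i) ⟨
      D ℤ.* ∑[ i < v ] (D ℤ.+ ℤ.- N i i)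
        ≡⟨ cong (D ℤ.*_) (∑-distrib-+ (λ _ → D) (λ i → ℤ.- N i i)) ⟩
      D ℤ.* (∑[ i < v ] D ℤ.+ ∑[ i < v ] (ℤ.- N i i))
        ≡⟨ cong (λ x → D ℤ.* (∑[ i < v ] D ℤ.+ x)) ∑-neg ⟩
      D ℤ.* (∑[ i < v ] D ℤ.- tr N)
        ≡⟨ cong (D ℤ.*_) (ℤ.i≡j⇒i-j≡0 (sym tr-XA)) ⟩
      D ℤ.* 0ℤ  ≡⟨ ℤ.*-zeroʳ D ⟩
      0ℤ        ∎
      where
      ∑-neg : ∑[ i < v ] (ℤ.- N i i) ≡ ℤ.- tr N
      ∑-neg = begin
        ∑[ i < v ] (ℤ.- N i i)         ≡⟨ sum-cong-≗ (λ i → sym (ℤ.-1*i≡-i (N i i))) ⟩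
        ∑[ i < v ] (ℤ.-1ℤ ℤ.* N i i)   ≡⟨ *-distribˡ-sum ℤ.-1ℤ (λ i → N i i) ⟨
        ℤ.-1ℤ ℤ.* tr N                 ≡⟨ ℤ.-1*i≡-i (tr N) ⟩
        ℤ.- tr N                       ∎

    -- The squares of the entries of `E` are nonnegative integers with total zero. This forces first
    -- every row sum, then every single square, to vanish.
    right-inverse⇒left-inverse : ∀ i j → N i j ≡ D ℤ.* δ i j
    right-inverse⇒left-inverse i j = ℤ.i-j≡0⇒i≡j (N i j) (D ℤ.* δ i j)
      -- Both factors of the vanishing product are `E i j`, so the two alternatives coincide.
      (reduce (ℤ.i*j≡0⇒i≡0∨j≡0 (E i j) E²≡0))
      where
      row≡0 = ∑-nonneg-≡0 (λ i → ∑[ j < v ] (E i j ℤ.* E i j))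
        (λ i → ∑-nonneg _ (λ j → i*i≥0 (E i j))) ∑-squares i
      E²≡0 = ∑-nonneg-≡0 (λ j → E i j ℤ.* E i j) (λ j → i*i≥0 (E i j)) row≡0 j

-- The scaled inverse obtained from the Gram condition.

module _ (A : Matrixℤ v) (d m : ℤ)
         (AAᵗ : ∀ i j → ∑[ l < v ] (A i l ℤ.* A j l) ≡ d ℤ.* δ i j ℤ.+ m) where

  private
    e : ℤ
    e = d ℤ.+ + v ℤ.* m

    column-sum : Fin v → ℤ
    column-sum j = ∑[ l < v ] A l j

  -- This comes from Aᵗ (A Aᵗ)⁻¹: the inverse of d I + m J is (e I - m J) / (e d), and clearing the
  -- denominator e d keeps the entries integral. `column-sum j` is the constant value of row `j` of
  -- Aᵗ J.
  gram-inverse : Matrixℤ v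
  gram-inverse j l = e ℤ.* A l j ℤ.- m ℤ.* column-sum j

  -- After exchanging the sums this is a row sum of A Aᵗ = d I + m J, so `e` is the eigenvalue of
  -- that matrix at the all-ones vector.
  gram-row-sum : ∀ i → ∑[ j < v ] (A i j ℤ.* column-sum j) ≡ e
  gram-row-sum i = begin
    ∑[ j < v ] (A i j ℤ.* column-sum j)
      ≡⟨ sum-cong-≗ (λ j → *-distribˡ-sum (A i j) (λ l → A l j)) ⟩
    ∑[ j < v ] ∑[ l < v ] (A i j ℤ.* A l j)
      ≡⟨ ∑-comm (λ j l → A i j ℤ.* A l j) ⟩
    ∑[ l < v ] ∑[ j < v ] (A i j ℤ.* A l j)
      ≡⟨ sum-cong-≗ (λ l → trans (AAᵗ i l) (cong (ℤ._+ m) (ℤ.*-comm d (δ i l)))) ⟩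
    ∑[ l < v ] (δ i l ℤ.* d ℤ.+ m)
      ≡⟨ ∑-distrib-+ (λ l → δ i l ℤ.* d) (λ _ → m) ⟩
    ∑[ l < v ] (δ i l ℤ.* d) ℤ.+ ∑[ l < v ] m
      ≡⟨ cong₂ ℤ._+_ (∑-δ i (λ _ → d)) (∑-const v m) ⟩
    e ∎

  -- The coefficient `e` is chosen so that the two multiples of J, `e * m` and `m * e`, cancel.
  gram-inverseʳ : ∀ i j → (A ∙ gram-inverse) i j ≡ e ℤ.* d ℤ.* δ i j
  gram-inverseʳ i j = begin
    (A ∙ gram-inverse) i j  ≡⟨ ∑-linear (A i) (A j) column-sum e m ⟩
    e ℤ.* ∑[ l < v ] (A i l ℤ.* A j l) ℤ.- m ℤ.* ∑[ l < v ] (A i l ℤ.* column-sum l)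
      ≡⟨ cong₂ (λ x y → e ℤ.* x ℤ.- m ℤ.* y) (AAᵗ i j) (gram-row-sum i) ⟩
    e ℤ.* (d ℤ.* δ i j ℤ.+ m) ℤ.- m ℤ.* e  ≡⟨ cancel e d (δ i j) m ⟩
    e ℤ.* d ℤ.* δ i j ∎
    where
    cancel : ∀ e d x m → e ℤ.* (d ℤ.* x ℤ.+ m) ℤ.- m ℤ.* e ≡ e ℤ.* d ℤ.* x
    cancel = solve-∀

  -- With s the vector of column sums, `formula` exhibits X A as e AᵗA - m s sᵗ, a combination of
  -- two symmetric matrices.
  gram-inverse-sym : ∀ i j → (gram-inverse ∙ A) i j ≡ (gram-inverse ∙ A) j i
  gram-inverse-sym i j = begin
    (gram-inverse ∙ A) i j  ≡⟨ formula i j ⟩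
    e ℤ.* ∑[ l < v ] (A l j ℤ.* A l i) ℤ.- m ℤ.* (column-sum j ℤ.* column-sum i)
      ≡⟨ cong₂ (λ x y → e ℤ.* x ℤ.- m ℤ.* y)
           (sum-cong-≗ (λ l → ℤ.*-comm (A l j) (A l i)))
           (ℤ.*-comm (column-sum j) (column-sum i)) ⟩
    e ℤ.* ∑[ l < v ] (A l i ℤ.* A l j) ℤ.- m ℤ.* (column-sum i ℤ.* column-sum j)
      ≡⟨ formula j i ⟨
    (gram-inverse ∙ A) j i ∎
    where
    formula : ∀ i j → (gram-inverse ∙ A) i j ≡
      e ℤ.* ∑[ l < v ] (A l j ℤ.* A l i) ℤ.- m ℤ.* (column-sum j ℤ.* column-sum i)
    formula i j = begin
      (gram-inverse ∙ A) i j
        ≡⟨ sum-cong-≗ (λ l → ℤ.*-comm (gram-inverse i l) (A l j)) ⟩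
      ∑[ l < v ] (A l j ℤ.* gram-inverse i l)
        ≡⟨ ∑-linear (λ l → A l j) (λ l → A l i) (λ _ → column-sum i) e m ⟩
      e ℤ.* ∑[ l < v ] (A l j ℤ.* A l i) ℤ.- m ℤ.* ∑[ l < v ] (A l j ℤ.* column-sum i)
        ≡⟨ cong (λ x → e ℤ.* ∑[ l < v ] (A l j ℤ.* A l i) ℤ.- m ℤ.* x)
             (*-distribʳ-sum (column-sum i) (λ l → A l j)) ⟨
      e ℤ.* ∑[ l < v ] (A l j ℤ.* A l i) ℤ.- m ℤ.* (column-sum j ℤ.* column-sum i) ∎

-- Fixed points as traces of permutation matrices.

count-tabulate : {P : Pred A p} (P? : Decidable P) (f : Fin n → A) →
  Vec.count P? (Vec.tabulate f) ≡ ℕ∑.sum-syntax n (λ i → if does (P? (f i)) then 1 else 0)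
count-tabulate {n = zero}  P? f = refl
count-tabulate {n = suc n} P? f with does (P? (f zero))
... | true  = cong suc (count-tabulate P? (f ∘ suc))
... | false = count-tabulate P? (f ∘ suc)

#fixedPoints-∑ : (σ : Permutation′ v) → + #fixedPoints σ ≡ ∑[ i < v ] δ (σ ⟨$⟩ʳ i) i
#fixedPoints-∑ σ = trans (cong +_ (count-tabulate (λ i → (σ ⟨$⟩ʳ i) ≟ i) (λ i → i)))
                         (pos-∑ (λ i → 𝟙 (σ ⟨$⟩ʳ i) i))

module _ (A X : Matrixℤ v) (D : ℤ) .{{_ : ℤ.NonZero D}}
         (AX≡D : ∀ i j → (A ∙ X) i j ≡ D ℤ.* δ i j)
         (XA≡D : ∀ i j → (X ∙ A) i j ≡ D ℤ.* δ i j) where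

  -- Since `D` is nonzero, A is invertible over the rationals, and invariance says that it
  -- conjugates the permutation matrices of `σ` and `τ` into each other. Equality of their traces is
  -- proved here with `D` as a common factor, cancelled at the end.
  invariant⇒#fixedPoints≡ : (σ τ : Permutation′ v) →
    (∀ i j → A i j ≡ A (σ ⟨$⟩ˡ i) (τ ⟨$⟩ˡ j)) → #fixedPoints σ ≡ #fixedPoints τ
  invariant⇒#fixedPoints≡ σ τ A-inv = ℤ.+-injective
    (ℤ.*-cancelˡ-≡ D (+ #fixedPoints σ) (+ #fixedPoints τ) (begin
      D ℤ.* + #fixedPoints σ                     ≡⟨ cong (D ℤ.*_) (#fixedPoints-∑ σ) ⟩
      D ℤ.* ∑[ l < v ] δ (σ ⟨$⟩ʳ l) l            ≡⟨ *-distribˡ-sum D (λ l → δ (σ ⟨$⟩ʳ l) l) ⟩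
      -- A permutation and its inverse fix the same points; the inverse is the form in which
      -- invariance is given.
      ∑[ l < v ] (D ℤ.* δ (σ ⟨$⟩ʳ l) l)          ≡⟨ sum-cong-≗ (λ l → cong (D ℤ.*_) (fixed l)) ⟩
      ∑[ l < v ] (D ℤ.* δ (σ ⟨$⟩ˡ l) l)          ≡⟨ sum-cong-≗ (λ l → AX≡D (σ ⟨$⟩ˡ l) l) ⟨
      ∑[ l < v ] ∑[ j < v ] (A (σ ⟨$⟩ˡ l) j ℤ.* X j l)
        ≡⟨ ∑-comm (λ l j → A (σ ⟨$⟩ˡ l) j ℤ.* X j l) ⟩
      ∑[ j < v ] ∑[ l < v ] (A (σ ⟨$⟩ˡ l) j ℤ.* X j l)
        ≡⟨ sum-cong-≗ (λ j → sum-cong-≗ (λ l → trans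
             (ℤ.*-comm (A (σ ⟨$⟩ˡ l) j) (X j l)) (cong (X j l ℤ.*_) (A-shift l j)))) ⟩
      ∑[ j < v ] (X ∙ A) j (τ ⟨$⟩ʳ j)            ≡⟨ sum-cong-≗ (λ j → XA≡D j (τ ⟨$⟩ʳ j)) ⟩
      ∑[ j < v ] (D ℤ.* δ j (τ ⟨$⟩ʳ j))
        ≡⟨ sum-cong-≗ (λ j → cong (D ℤ.*_) (δ-sym j (τ ⟨$⟩ʳ j))) ⟩
      ∑[ j < v ] (D ℤ.* δ (τ ⟨$⟩ʳ j) j)          ≡⟨ *-distribˡ-sum D (λ j → δ (τ ⟨$⟩ʳ j) j) ⟨
      D ℤ.* ∑[ j < v ] δ (τ ⟨$⟩ʳ j) j            ≡⟨ cong (D ℤ.*_) (#fixedPoints-∑ τ) ⟨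
      D ℤ.* + #fixedPoints τ                     ∎))
    where
    fixed : ∀ l → δ (σ ⟨$⟩ʳ l) l ≡ δ (σ ⟨$⟩ˡ l) l
    fixed l = δ-cong (mk⇔
      (λ eq → trans (cong (σ ⟨$⟩ˡ_) (sym eq)) (inverseˡ σ))
      (λ eq → trans (cong (σ ⟨$⟩ʳ_) (sym eq)) (inverseʳ σ)))
    -- Invariance taken at column `τ ⟨$⟩ʳ j` trades the permutation of the row for one of the
    -- column, so that the inner sum over `l` becomes an entry of `X ∙ A`.
    A-shift : ∀ l j → A (σ ⟨$⟩ˡ l) j ≡ A l (τ ⟨$⟩ʳ j)
    A-shift l j = sym (trans (A-inv l (τ ⟨$⟩ʳ j)) (cong (A (σ ⟨$⟩ˡ l)) (inverseˡ τ)))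

-- Sums over all tuples and invariance of projections.

sum-map-filter : {P : Pred A p} (P? : Decidable P) (f : A → ℕ) (xs : List A) →
  sum (List.map f (List.filter P? xs)) ≡
  sum (List.map (λ x → if does (P? x) then f x else 0) xs)
sum-map-filter P? f List.[]       = refl
sum-map-filter P? f (x List.∷ xs) with does (P? x)
... | true  = cong (_+_ (f x)) (sum-map-filter P? f xs)
... | false = sum-map-filter P? f xs

-- The function `g` is arbitrary for the sake of the induction: the tail of the tabulation of `g` is
-- the tabulation of `g ∘ suc`.
sum-map-cartesianProductWith :
  ∀ {b c} {B : Set b} {C : Set c} (_∘₂_ : A → B → C) (g : Fin n → A) (ys : List B) (f : C → ℕ) →
  sum (List.map f (List.cartesianProductWith _∘₂_ (List.tabulate g) ys)) ≡
  ℕ∑.sum-syntax n (λ i → sum (List.map (λ y → f (g i ∘₂ y)) ys))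
sum-map-cartesianProductWith {n = zero}  _∘₂_ g ys f = refl
sum-map-cartesianProductWith {n = suc n} _∘₂_ g ys f = begin
  sum (List.map f (List.map (g zero ∘₂_) ys List.++ rest))
    ≡⟨ cong sum (map-++ f (List.map (g zero ∘₂_) ys) rest) ⟩
  sum (List.map f (List.map (g zero ∘₂_) ys) List.++ List.map f rest)
    ≡⟨ sum-++ (List.map f (List.map (g zero ∘₂_) ys)) (List.map f rest) ⟩
  sum (List.map f (List.map (g zero ∘₂_) ys)) + sum (List.map f rest)
    ≡⟨ cong₂ _+_ (cong sum (sym (map-∘ ys)))
         (sum-map-cartesianProductWith _∘₂_ (g ∘ suc) ys f) ⟩
  _ ∎
  where
  rest = List.cartesianProductWith _∘₂_ (List.tabulate (g ∘ suc)) ys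

-- The permutations act coordinatewise, so one coordinate is reindexed at a time, by induction on
-- the length.
sum-allTuples-permute : (π : Vec (Permutation′ v) n) (f : Tuple n v → ℕ) →
  sum (List.map f (allTuples n v)) ≡
  sum (List.map (f ∘ Vec.zipWith _⟨$⟩ˡ_ π) (allTuples n v))
sum-allTuples-permute []              f = refl
sum-allTuples-permute {v} {suc n} (σ ∷ π) f = begin
  sum (List.map f (allTuples (suc n) v))
    ≡⟨ sum-map-cartesianProductWith _∷_ (λ i → i) (allTuples n v) f ⟩
  ℕ∑.sum-syntax v (λ i → sum (List.map (f ∘ (i ∷_)) (allTuples n v)))
    -- `∑-permute` reindexes in the forward direction, while tuples are moved by inverses; hence
    -- `flip`.
    ≡⟨ ℕ∑.∑-permute _ (flip σ) ⟩
  ℕ∑.sum-syntax v (λ i → sum (List.map (f ∘ ((σ ⟨$⟩ˡ i) ∷_)) (allTuples n v)))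
    ≡⟨ ℕ∑.sum-cong-≗ (λ i → sum-allTuples-permute π (f ∘ ((σ ⟨$⟩ˡ i) ∷_))) ⟩
  ℕ∑.sum-syntax v (λ i →
    sum (List.map (λ t → f ((σ ⟨$⟩ˡ i) ∷ Vec.zipWith _⟨$⟩ˡ_ π t)) (allTuples n v)))
    ≡⟨ sum-map-cartesianProductWith _∷_ (λ i → i) (allTuples n v)
         (f ∘ Vec.zipWith _⟨$⟩ˡ_ (σ ∷ π)) ⟨
  sum (List.map (f ∘ Vec.zipWith _⟨$⟩ˡ_ (σ ∷ π)) (allTuples (suc n) v)) ∎

-- The autotopy maps the tuples lying over `(i , j)` bijectively onto those over the image pair and
-- preserves the value of `C`.
Π-invariant : (π : Vec (Permutation′ v) n) (C : ZeroOneArray n v) → IsAutotopy π C →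
  ∀ x y i j → Π x y C i j ≡ Π x y C (lookup π x ⟨$⟩ˡ i) (lookup π y ⟨$⟩ˡ j)
Π-invariant {v} {n} π C autotopy x y i j = begin
  Π x y C i j
    -- Replacing the filter by a weight that is zero off the fibre makes both entries sums over the
    -- same full list, which can then be reindexed.
    ≡⟨ sum-map-filter (over i j) (λ t → toℕ (C t)) (allTuples n v) ⟩
  sum (List.map (weight i j) (allTuples n v))
    ≡⟨ cong sum (map-cong weight-invariant (allTuples n v)) ⟩
  sum (List.map (weight i′ j′ ∘ Vec.zipWith _⟨$⟩ˡ_ π) (allTuples n v))
    ≡⟨ sum-allTuples-permute π (weight i′ j′) ⟨
  sum (List.map (weight i′ j′) (allTuples n v))
    ≡⟨ sum-map-filter (over i′ j′) (λ t → toℕ (C t)) (allTuples n v) ⟨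
  Π x y C i′ j′ ∎
  where
  i′ = lookup π x ⟨$⟩ˡ i
  j′ = lookup π y ⟨$⟩ˡ j
  over = λ i j (t : Tuple n v) → (lookup t x ≟ i) ×-dec (lookup t y ≟ j)
  weight : Fin v → Fin v → Tuple n v → ℕ
  weight i j t = if does (over i j t) then toℕ (C t) else 0

  lookup-permuted : ∀ (t : Tuple n v) z l →
    lookup t z ≡ l ⇔ lookup (Vec.zipWith _⟨$⟩ˡ_ π t) z ≡ lookup π z ⟨$⟩ˡ l
  lookup-permuted t z l rewrite lookup-zipWith _⟨$⟩ˡ_ z π t = mk⇔
    (cong (lookup π z ⟨$⟩ˡ_))
    (λ eq → trans (sym (inverseʳ (lookup π z)))
              (trans (cong (lookup π z ⟨$⟩ʳ_) eq) (inverseʳ (lookup π z))))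

  weight-invariant : ∀ t → weight i j t ≡ weight i′ j′ (Vec.zipWith _⟨$⟩ˡ_ π t)
  weight-invariant t = cong₂ (λ b c → if b then toℕ c else 0)
    (does-⇔ (lookup-permuted t x i ×-⇔ lookup-permuted t y j)
      (over i j t) (over i′ j′ (Vec.zipWith _⟨$⟩ˡ_ π t)))
    (autotopy t)

-- Application to incidence matrices and autotopies.

module _ {k μ : ℕ} (μ<k : μ < k) (A : Matrix v) (inc : IsIncidenceMatrix v k μ A) where

  private
    d m D : ℤ
    d = + (k ∸ μ)
    m = + μ
    D = (d ℤ.+ + v ℤ.* m) ℤ.* d

    Aℤ : Matrixℤ v
    Aℤ i j = + A i j

    gramℤ : ∀ i j → ∑[ l < v ] (Aℤ i l ℤ.* Aℤ j l) ≡ d ℤ.* δ i j ℤ.+ m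
    gramℤ i j = begin
      ∑[ l < v ] (Aℤ i l ℤ.* Aℤ j l)  ≡⟨ sum-cong-≗ (λ l → ℤ.pos-* (A i l) (A j l)) ⟨
      ∑[ l < v ] (+ (A i l * A j l))  ≡⟨ pos-∑ (λ l → A i l * A j l) ⟨
      + (A ⊗ A ᵗ) i j                 ≡⟨ cong +_ (IsIncidenceMatrix.gram inc i j) ⟩
      + ((k ∸ μ) * 𝟙 i j + μ * 1)
        ≡⟨ cong₂ ℤ._+_ (ℤ.pos-* (k ∸ μ) (𝟙 i j)) (cong +_ (*-identityʳ μ)) ⟩
      d ℤ.* δ i j ℤ.+ m               ∎

    D≢0 : ℤ.NonZero D
    D≢0 = ℤ.i*j≢0 (d ℤ.+ + v ℤ.* m) d {{e≢0}} {{d≢0}}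
      where
      -- Nondegeneracy `μ < k` enters here: it makes `d` positive, and `e` is at least `d`. For an
      -- integer, `NonZero` refers to its absolute value, so facts about natural numbers apply.
      d≢0 : ℤ.NonZero d
      d≢0 = >-nonZero (m<n⇒0<n∸m μ<k)
      e≢0 : ℤ.NonZero (d ℤ.+ + v ℤ.* m)
      e≢0 = subst (λ x → ℤ.NonZero (d ℤ.+ x)) (ℤ.pos-* v μ)
        (>-nonZero (≤-trans (m<n⇒0<n∸m μ<k) (m≤m+n (k ∸ μ) (v * μ))))

    X : Matrixℤ v
    X = gram-inverse Aℤ d m gramℤ

    AX≡D : ∀ i j → (Aℤ ∙ X) i j ≡ D ℤ.* δ i j
    AX≡D = gram-inverseʳ Aℤ d m gramℤ

  automorphism⇒#fixedPoints≡ : (σ τ : Permutation′ v) →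
    (∀ i j → A i j ≡ A (σ ⟨$⟩ˡ i) (τ ⟨$⟩ˡ j)) → #fixedPoints σ ≡ #fixedPoints τ
  automorphism⇒#fixedPoints≡ σ τ A-inv =
    invariant⇒#fixedPoints≡ Aℤ X D {{D≢0}} AX≡D
      (right-inverse⇒left-inverse Aℤ X D AX≡D (gram-inverse-sym Aℤ d m gramℤ))
      σ τ (λ i j → cong +_ (A-inv i j))

proposition3p3 : ∀ (n v k μ : ℕ) → 2 ≤ n → μ < k →
    (C : ZeroOneArray n v) → 𝒫 n v k μ C →
    (π : Vec (Permutation′ v) n) → IsAutotopy π C →
    ∀ (x y : Fin n) → #fixedPoints (lookup π x) ≡ #fixedPoints (lookup π y)
proposition3p3 n v k μ _ μ<k C C∈𝒫 π autotopy = main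
  where
  ordered : ∀ x y → x Fin.< y →
            #fixedPoints (lookup π x) ≡ #fixedPoints (lookup π y)
  ordered x y x<y = automorphism⇒#fixedPoints≡ μ<k (Π x y C) (C∈𝒫 x y x<y)
    (lookup π x) (lookup π y) (Π-invariant π C autotopy x y)

  main : ∀ x y → #fixedPoints (lookup π x) ≡ #fixedPoints (lookup π y)
  -- `𝒫` speaks only of pairs with `x < y`; the reverse order follows by symmetry of the equality.
  main x y with <-cmp x y
  ... | tri< x<y _ _  = ordered x y x<y
  ... | tri≈ _ refl _ = refl
  ... | tri> _ _ y<x  = sym (ordered y x y<x)
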